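{- Let $a\geq 1$ and $n,p>1$ be integers and let $G$ be a regular graph. Then $apG\circ nK_1$ is distance magic if and only if $aH_{n,p}\otimes G$ is distance magic.
   Context: A graph $G$ on $v$ vertices is distance magic if there is a bijection $f:V(G)\to\{1,\ldots,v\}$ and a constant $k$ such that for every vertex $x$, $\sum_{y\in N(x)}f(y)=k$, where $N(x)$ is the set of neighbours of $x$. $H_{n,p}$ denotes the complete multipartite graph with $p$ partite sets each of size $n$; $cH$ denotes the disjoint union of $c$ copies of $H$; $nK_1$ is the edgeless graph on $n$ vertices. The lexicographic product $G\circ H$ has vertex set $V(G)\times V(H)$, with $(g,h)\sim(g',h')$ iff $gg'\in E(G)$, or $g=g'$ and $hh'\in E(H)$. The Kronecker (tensor) product $G\otimes H$ has vertex set $V(G)\times V(H)$, with $(g,h)\sim(g',h')$ iff $gg'\in E(G)$ and $hh'\in E(H)$. -}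

module Defs where

open import Data.Empty using (⊥)
open import Data.Fin.Base using (Fin; toℕ)
open import Data.Fin.Properties using (*↔×; inj⇒≟) renaming (_≟_ to _≟ᶠ_)
open import Data.List.Base using (List; allFin; filter; length; map; sum)
open import Data.Nat.Base using (ℕ; suc; _*_)
open import Data.Product.Base using (Σ-syntax; ∃-syntax; _×_; _,_; proj₁)
open import Data.Product.Function.NonDependent.Propositional using (_×-↔_)
open import Data.Sum.Base using (_⊎_; inj₁; inj₂)
open import Function.Bundles using (_↔_; _⤖_; Inverse; Bijection)
open import Function.Properties.Inverse using (↔-refl; ↔-sym; ↔-trans; ↔⇒↣)
open import Relation.Binary.Core using (Rel)
open import Relation.Binary.Definitions using (Decidable; DecidableEquality; Irreflexive; Symmetric)
open import Relation.Binary.PropositionalEquality.Core using (_≡_; _≢_; refl; sym; ≢-sym)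
open import Relation.Nullary.Decidable.Core using (no; _×-dec_; _⊎-dec_; ¬?)
open import Level using (0ℓ)

-- Finite simple graphs. The enumeration only serves to count and to sum over
-- vertices; it plays no role in adjacency.
record Graph : Set₁ where
  field
    V      : Set
    order  : ℕ
    enum   : V ↔ Fin order
    _∼_    : Rel V 0ℓ
    _∼?_   : Decidable _∼_
    ∼-sym  : Symmetric _∼_
    ∼-irr  : Irreflexive _≡_ _∼_

  vertices : List V
  vertices = map (Inverse.from enum) (allFin order)

  neighbours : V → List V
  neighbours x = filter (x ∼?_) vertices

  degree : V → ℕ
  degree x = length (neighbours x)

  _≟_ : DecidableEquality V
  _≟_ = inj⇒≟ (↔⇒↣ enum)

Regular : Graph → Set
Regular G = ∃[ r ] (∀ x → degree x ≡ r)
  where open Graph G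

-- A bijection onto {1,…,v} is given as a bijection onto Fin v = {0,…,v-1},
-- shifted by one.
DistanceMagic : Graph → Set
DistanceMagic G =
  Σ[ f ∈ V ⤖ Fin order ] ∃[ k ]
    (∀ x → sum (map (λ y → suc (toℕ (Bijection.to f y))) (neighbours x)) ≡ k)
  where open Graph G

×-enum : ∀ {A B : Set} {m n} → A ↔ Fin m → B ↔ Fin n → (A × B) ↔ Fin (m * n)
×-enum e e′ = ↔-trans (e ×-↔ e′) (↔-sym *↔×)

-- n K₁
edgeless : ℕ → Graph
edgeless n = record
  { V     = Fin n
  ; order = n
  ; enum  = ↔-refl
  ; _∼_   = λ _ _ → ⊥
  ; _∼?_  = λ _ _ → no λ ()
  ; ∼-sym = λ ()
  ; ∼-irr = λ _ ()
  }

-- H_{n,p}: p partite sets of size n; the vertex (i , j) is the j-th vertex of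
-- the i-th partite set.
completeMultipartite : (n p : ℕ) → Graph
completeMultipartite n p = record
  { V     = Fin p × Fin n
  ; order = p * n
  ; enum  = ×-enum ↔-refl ↔-refl
  ; _∼_   = λ x y → proj₁ x ≢ proj₁ y
  ; _∼?_  = λ x y → ¬? (proj₁ x ≟ᶠ proj₁ y)
  ; ∼-sym = ≢-sym
  ; ∼-irr = λ { refl i≢i → i≢i refl }
  }

-- c G, the disjoint union of c copies of G
copies : ℕ → Graph → Graph
copies c G = record
  { V     = Fin c × V
  ; order = c * order
  ; enum  = ×-enum ↔-refl enum
  ; _∼_   = λ (i , x) (j , y) → i ≡ j × x ∼ y
  ; _∼?_  = λ (i , x) (j , y) → (i ≟ᶠ j) ×-dec (x ∼? y)
  ; ∼-sym = λ (i≡j , x∼y) → sym i≡j , ∼-sym x∼y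
  ; ∼-irr = λ { refl (_ , x∼x) → ∼-irr refl x∼x }
  }
  where open Graph G

infixl 7 _∘_ _⊗_

-- Lexicographic product
_∘_ : Graph → Graph → Graph
G ∘ H = record
  { V     = G.V × H.V
  ; order = G.order * H.order
  ; enum  = ×-enum G.enum H.enum
  ; _∼_   = λ (g , h) (g′ , h′) → g G.∼ g′ ⊎ (g ≡ g′ × h H.∼ h′)
  ; _∼?_  = λ (g , h) (g′ , h′) → (g G.∼? g′) ⊎-dec ((g G.≟ g′) ×-dec (h H.∼? h′))
  ; ∼-sym = λ { (inj₁ g∼g′)          → inj₁ (G.∼-sym g∼g′)
              ; (inj₂ (g≡g′ , h∼h′)) → inj₂ (sym g≡g′ , H.∼-sym h∼h′) }
  ; ∼-irr = λ { refl (inj₁ g∼g)       → G.∼-irr refl g∼g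
              ; refl (inj₂ (_ , h∼h)) → H.∼-irr refl h∼h }
  }
  where
  module G = Graph G
  module H = Graph H

-- Kronecker (tensor) product
_⊗_ : Graph → Graph → Graph
G ⊗ H = record
  { V     = G.V × H.V
  ; order = G.order * H.order
  ; enum  = ×-enum G.enum H.enum
  ; _∼_   = λ (g , h) (g′ , h′) → g G.∼ g′ × h H.∼ h′
  ; _∼?_  = λ (g , h) (g′ , h′) → (g G.∼? g′) ×-dec (h H.∼? h′)
  ; ∼-sym = λ (g∼g′ , h∼h′) → G.∼-sym g∼g′ , H.∼-sym h∼h′
  ; ∼-irr = λ { refl (g∼g , _) → G.∼-irr refl g∼g }
  }
  where
  module G = Graph G
  module H = Graph H

{-# OPTIONS --safe #-}

-- Write S(b,i,x) for the total label of the n copies of the neighbours of x in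
-- the copy of G indexed by (b,i), where b < a and i < p.  The neighbour sums
-- of apG ∘ nK₁ are the S(b,i,x), and those of aH_{n,p} ⊗ G are the sums of
-- S(b,i′,x) over i′ ≠ i.  If the former all equal k, the latter all equal
-- (p − 1)k.  Conversely, if the latter all equal k′, then comparing with the
-- sum over all i′ shows that S(b,i,x) does not depend on i, whence
-- (p − 1)S(b,i,x) = k′.

module Submission where

open import Defs
open import Data.Fin.Base using (Fin; combine; remQuot; toℕ)
open import Data.Fin.Properties using (combine-remQuot; remQuot-combine) renaming (_≟_ to _≟ᶠ_)
open import Data.List.Base using (List; []; _∷_; _++_; allFin; cartesianProduct; cartesianProductWith; filter; length; map)
open import Data.List.Membership.Propositional using (_∈_)
open import Data.List.Membership.Propositional.Properties using (∈-allFin; ∈-cartesianProduct⁺; ∈-cartesianProduct⁻; ∈-cartesianProductWith⁺; ∈-cartesianProductWith⁻; ∈-filter⁺; ∈-filter⁻; ∈-map⁺; ∈-map⁻)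
open import Data.List.Membership.Propositional.Properties.WithK using (unique∧set⇒bag)
open import Data.List.Properties using (length-tabulate; map-++; map-cong; map-∘)
open import Data.List.Relation.Binary.BagAndSetEquality using (∼bag⇒↭)
open import Data.List.Relation.Binary.Permutation.Propositional using (_↭_)
open import Data.List.Relation.Binary.Permutation.Propositional.Properties using (↭-length) renaming (map⁺ to ↭-map⁺)
open import Data.List.Relation.Unary.All.Properties using (all-filter)
open import Data.List.Relation.Unary.AllPairs.Core using (_∷_)
open import Data.List.Relation.Unary.Any using (here; there)
open import Data.List.Relation.Unary.Unique.Propositional using (Unique)
open import Data.List.Relation.Unary.Unique.Propositional.Properties using (allFin⁺; cartesianProduct⁺; cartesianProductWith⁺; filter⁺; map⁺)
open import Data.Nat.Base using (ℕ; suc; s≤s; _+_; _*_; _≥_; _>_)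
open import Data.Nat.DivMod using (_/_; m*n/n≡m)
open import Data.Nat.ListAction using (sum)
open import Data.Nat.ListAction.Properties using (sum-++; sum-↭)
open import Data.Nat.Properties using (+-cancelʳ-≡; *-comm; suc-injective)
open import Data.Nat.Tactic.RingSolver using (solve-∀)
open import Data.Product.Base using (Σ-syntax; _×_; _,_; proj₁; proj₂)
open import Data.Sum.Base using (inj₁)
open import Function.Bundles using (_⇔_; _↔_; _⤖_; Bijection; Inverse; mk⇔; mk↔ₛ′)
open import Function.Properties.Bijection using () renaming (trans to ⤖-trans)
open import Function.Properties.Inverse using (↔-sym; ↔⇒⤖)
open import Relation.Binary.PropositionalEquality using (_≡_; refl; sym; trans; cong; cong₂; subst; module ≡-Reasoning)
open import Relation.Nullary.Decidable.Core using (yes; no; ¬?)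

private
  variable
    A B C : Set

-- Without repetitions, equal membership forces equal multiplicity. So any neighbour list, whatever
-- the order of its enumeration, can be traded for an explicitly built list with the same members
-- without changing a sum over it.
unique∧⇔⇒↭ : ∀ {xs ys : List A} → Unique xs → Unique ys →
             (∀ {v} → v ∈ xs → v ∈ ys) → (∀ {v} → v ∈ ys → v ∈ xs) → xs ↭ ys
unique∧⇔⇒↭ uxs uys to from = ∼bag⇒↭ (unique∧set⇒bag uxs uys (mk⇔ to from))

sum-map-↭ : ∀ (w : A → ℕ) {xs ys} → xs ↭ ys → sum (map w xs) ≡ sum (map w ys)
sum-map-↭ w p = sum-↭ (↭-map⁺ w p)

sum-map-const : ∀ (c : ℕ) (xs : List A) → sum (map (λ _ → c) xs) ≡ length xs * c
sum-map-const c []       = refl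
sum-map-const c (_ ∷ xs) = cong (c +_) (sum-map-const c xs)

sum-cartesianProductWith : ∀ (w : C → ℕ) (g : A → B → C) xs ys →
  sum (map w (cartesianProductWith g xs ys)) ≡
  sum (map (λ x → sum (map (λ y → w (g x y)) ys)) xs)
sum-cartesianProductWith w g []       ys = refl
sum-cartesianProductWith w g (x ∷ xs) ys = begin
  sum (map w (map (g x) ys ++ rest))               ≡⟨ cong sum (map-++ w (map (g x) ys) rest) ⟩
  sum (map w (map (g x) ys) ++ map w rest)         ≡⟨ sum-++ (map w (map (g x) ys)) _ ⟩
  sum (map w (map (g x) ys)) + sum (map w rest)
    ≡⟨ cong₂ _+_ (cong sum (sym (map-∘ ys))) (sum-cartesianProductWith w g xs ys) ⟩
  sum (map (λ y → w (g x y)) ys) + sum (map (λ z → sum (map (λ y → w (g z y)) ys)) xs) ∎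
  where
  open ≡-Reasoning
  rest = cartesianProductWith g xs ys

others : ∀ {p} → Fin p → List (Fin p)
others {p} i = filter (λ j → ¬? (i ≟ᶠ j)) (allFin p)

allFin↭i∷others : ∀ {p} (i : Fin p) → allFin p ↭ i ∷ others i
allFin↭i∷others {p} i = unique∧⇔⇒↭ (allFin⁺ p)
  -- `all-filter` says that `i` differs from every member of `others i`.
  (all-filter _ (allFin p) ∷ filter⁺ _ (allFin⁺ p)) to (λ _ → ∈-allFin _)
  where
  to : ∀ {j} → j ∈ allFin p → j ∈ i ∷ others i
  to {j} j∈ with i ≟ᶠ j
  ... | yes refl = here refl
  ... | no i≢j   = there (∈-filter⁺ _ j∈ i≢j)

length-others : ∀ {m} (i : Fin (suc m)) → length (others i) ≡ m
length-others {m} i = suc-injective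
  (trans (sym (↭-length (allFin↭i∷others i))) (length-tabulate {n = suc m} (λ j → j)))

sum-others-const : ∀ {m} (s : Fin (suc m) → ℕ) {c} → (∀ i → s i ≡ c) →
                   ∀ i → sum (map s (others i)) ≡ m * c
sum-others-const {m} s {c} s≡c i = begin
  sum (map s (others i))          ≡⟨ cong sum (map-cong s≡c (others i)) ⟩
  sum (map (λ _ → c) (others i))  ≡⟨ sum-map-const c (others i) ⟩
  length (others i) * c           ≡⟨ cong (_* c) (length-others i) ⟩
  m * c                           ∎
  where open ≡-Reasoning

-- The full sum is `s j + k` for every `j`, so cancelling `k` makes `s` constant. The result stays
-- in multiplied form, which also covers `m` = 0; division is left until the factor is known to be
-- positive.
sum-others≡k⇒k≡m*s : ∀ {m} (s : Fin (suc m) → ℕ) {k} → (∀ i → sum (map s (others i)) ≡ k) →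
                       ∀ i → k ≡ m * s i
sum-others≡k⇒k≡m*s {m} s {k} eq i = trans (sym (eq i)) (sum-others-const s s-const i)
  where
  total : ∀ j → sum (map s (allFin (suc m))) ≡ s j + k
  total j = trans (sum-map-↭ s (allFin↭i∷others j)) (cong (s j +_) (eq j))

  s-const : ∀ j → s j ≡ s i
  s-const j = +-cancelʳ-≡ k (s j) (s i) (trans (sym (total j)) (total i))

module _ (G : Graph) where
  open Graph G

  vertices-unique : Unique vertices
  vertices-unique = map⁺ (Bijection.injective (↔⇒⤖ (↔-sym enum))) (allFin⁺ order)

  ∈-vertices : ∀ x → x ∈ vertices
  ∈-vertices x = subst (_∈ vertices) (Inverse.strictlyInverseʳ enum x)
    (∈-map⁺ (Inverse.from enum) (∈-allFin (Inverse.to enum x)))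

  neighbours-unique : ∀ x → Unique (neighbours x)
  neighbours-unique x = filter⁺ (x ∼?_) vertices-unique

  ∈-neighbours⁺ : ∀ {x y} → x ∼ y → y ∈ neighbours x
  ∈-neighbours⁺ {x} {y} x∼y = ∈-filter⁺ (x ∼?_) (∈-vertices y) x∼y

  ∈-neighbours⁻ : ∀ {x y} → y ∈ neighbours x → x ∼ y
  ∈-neighbours⁻ {x} y∈ = proj₂ (∈-filter⁻ (x ∼?_) {xs = vertices} y∈)

  neighbourSum : (V → ℕ) → V → ℕ
  neighbourSum w x = sum (map w (neighbours x))

  fibre : ∀ n → V → List (V × Fin n)
  fibre n x = cartesianProduct (neighbours x) (allFin n)

  fibre-unique : ∀ n x → Unique (fibre n x)
  fibre-unique n x = cartesianProduct⁺ (neighbours-unique x) (allFin⁺ n)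

  ∈-fibre⁺ : ∀ {n x y h} → x ∼ y → (y , h) ∈ fibre n x
  ∈-fibre⁺ x∼y = ∈-cartesianProduct⁺ (∈-neighbours⁺ x∼y) (∈-allFin _)

  ∈-fibre⁻ : ∀ {n x y h} → (y , h) ∈ fibre n x → x ∼ y
  ∈-fibre⁻ {n} {x} m = ∈-neighbours⁻ (proj₁ (∈-cartesianProduct⁻ (neighbours x) (allFin n) m))

  -- When `w` is a labelling restricted to the copy of `G` indexed by (b,i), this is S(b,i,x).
  fibreSum : ∀ {n} → (V × Fin n → ℕ) → V → ℕ
  fibreSum {n} w x = sum (map w (fibre n x))

module _ (G : Graph) (n : ℕ) where
  open Graph G

  -- An edge of the product can only come from an edge of `G` inside copy `i`, and the last
  -- coordinate of its far end is then free. Hence `j` has no influence on the sum.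
  neighbourSum-copies-∘-edgeless : ∀ {c} (w : (Fin c × V) × Fin n → ℕ) i x j →
    neighbourSum (copies c G ∘ edgeless n) w ((i , x) , j) ≡
    fibreSum G (λ (y , h) → w ((i , y) , h)) x
  neighbourSum-copies-∘-edgeless {c} w i x j = trans
    (sum-map-↭ w (unique∧⇔⇒↭ (neighbours-unique L ((i , x) , j))
      (map⁺ (λ { refl → refl }) (fibre-unique G n x)) to from))
    (cong sum (sym (map-∘ (fibre G n x))))
    where
    L : Graph
    L = copies c G ∘ edgeless n

    g : V × Fin n → Graph.V L
    g (y , h) = (i , y) , h

    to : ∀ {v} → v ∈ Graph.neighbours L ((i , x) , j) → v ∈ map g (fibre G n x)
    to v∈ with ∈-neighbours⁻ L {(i , x) , j} v∈
    -- The `inj₂` case would contain an edge of `edgeless n`, so it is absent.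
    ... | inj₁ (refl , x∼y) = ∈-map⁺ g (∈-fibre⁺ G x∼y)

    from : ∀ {v} → v ∈ map g (fibre G n x) → v ∈ Graph.neighbours L ((i , x) , j)
    from v∈ with (y , h) , yh∈ , refl ← ∈-map⁻ g v∈ =
      ∈-neighbours⁺ L {(i , x) , j} (inj₁ (refl , ∈-fibre⁻ G yh∈))

  -- Adjacency fixes `b`, requires a different partite set and an edge of `G`, and leaves the
  -- position within the partite set free. Grouping the neighbours by partite set gives one fibre
  -- for each `i′` other than `i`.
  neighbourSum-copies-⊗ : ∀ {a p} (w : (Fin a × (Fin p × Fin n)) × V → ℕ) b i j x →
    neighbourSum (copies a (completeMultipartite n p) ⊗ G) w ((b , (i , j)) , x) ≡
    sum (map (λ i′ → fibreSum G (λ (y , h) → w ((b , (i′ , h)) , y)) x) (others i))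
  neighbourSum-copies-⊗ {a} {p} w b i j x = trans
    (sum-map-↭ w (unique∧⇔⇒↭ (neighbours-unique R u)
      (cartesianProductWith⁺ g (λ { refl → refl , refl })
        (filter⁺ _ (allFin⁺ p)) (fibre-unique G n x)) to from))
    (sum-cartesianProductWith w g (others i) (fibre G n x))
    where
    R : Graph
    R = copies a (completeMultipartite n p) ⊗ G

    u : Graph.V R
    u = (b , (i , j)) , x

    g : Fin p → V × Fin n → Graph.V R
    g i′ (y , h) = (b , (i′ , h)) , y

    to : ∀ {v} → v ∈ Graph.neighbours R u → v ∈ cartesianProductWith g (others i) (fibre G n x)
    to v∈ with ∈-neighbours⁻ R {u} v∈
    ... | (refl , i≢i′) , x∼y =
      ∈-cartesianProductWith⁺ g (∈-filter⁺ _ (∈-allFin _) i≢i′) (∈-fibre⁺ G x∼y)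

    from : ∀ {v} → v ∈ cartesianProductWith g (others i) (fibre G n x) → v ∈ Graph.neighbours R u
    from v∈ with i′ , _ , i′∈ , yh∈ , refl ← ∈-cartesianProductWith⁻ g (others i) (fibre G n x) v∈ =
      ∈-neighbours⁺ R {u}
        ((refl , proj₂ (∈-filter⁻ _ {xs = allFin p} i′∈)) , ∈-fibre⁻ G yh∈)

-- Copy number c of `G` is read as a pair (b,i). This matches vertices only and does not preserve
-- adjacency; it serves to carry labels from one graph to the other.
reindex : ∀ {a n p} → ((Fin (a * p) × A) × Fin n) ↔ ((Fin a × (Fin p × Fin n)) × A)
reindex {A} {a} {n} {p} = mk↔ₛ′ to from
  (λ ((b , (i , h)) , y) → cong (λ bi → to′ bi y h) (remQuot-combine b i))
  (λ ((c , y) , h) → cong (λ c′ → (c′ , y) , h) (combine-remQuot {a} p c))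
  where
  -- Keeping the pair as a single argument reduces the round trip to `cong` along `remQuot-combine`.
  to′ : Fin a × Fin p → A → Fin n → (Fin a × (Fin p × Fin n)) × A
  to′ (b , i) y h = (b , (i , h)) , y

  to : (Fin (a * p) × A) × Fin n → (Fin a × (Fin p × Fin n)) × A
  to ((c , y) , h) = to′ (remQuot p c) y h

  from : (Fin a × (Fin p × Fin n)) × A → (Fin (a * p) × A) × Fin n
  from ((b , (i , h)) , y) = (combine b i , y) , h

label : ∀ {m} → A ⤖ Fin m → A → ℕ
label f x = suc (toℕ (Bijection.to f x))

-- The orders of the two graphs agree only propositionally. Matching on that equality here makes the
-- label equation hold by computation and keeps transports out of the sums.
relabel : ∀ {m n} (e : A ↔ B) → m ≡ n → (f : B ⤖ Fin m) →
          Σ[ g ∈ A ⤖ Fin n ] (∀ x → label g x ≡ label f (Inverse.to e x))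
relabel e refl f = ⤖-trans (↔⇒⤖ e) f , λ _ → refl

order-reindex : ∀ a n p o → a * p * o * n ≡ a * (p * n) * o
order-reindex = solve-∀

module _ (a n m : ℕ) (G : Graph) where
  open Graph G

  private
    p = suc m
    L = copies (a * p) G ∘ edgeless n
    R = copies a (completeMultipartite n p) ⊗ G

  distanceMagic-∘⇒⊗ : DistanceMagic L → DistanceMagic R
  distanceMagic-∘⇒⊗ (f , k , magic)
    with g , g≡ ← relabel (↔-sym (reindex {a = a})) (order-reindex a n p order) f =
    g , m * k , λ ((b , (i , j)) , x) → begin
      neighbourSum R (label g) ((b , (i , j)) , x)
        ≡⟨ cong sum (map-cong g≡ (Graph.neighbours R ((b , (i , j)) , x))) ⟩
      neighbourSum R (λ v → label f (Inverse.from reindex v)) ((b , (i , j)) , x)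
        ≡⟨ neighbourSum-copies-⊗ G n _ b i j x ⟩
      sum (map (λ i′ → fibreSum G (λ (y , h) → label f ((combine b i′ , y) , h)) x) (others i))
        -- Each S(b,i′,x) is a neighbour sum at some vertex of `L`; any last coordinate would do,
        -- and `j` is at hand.
        ≡⟨ sum-others-const _ (λ i′ → trans
             (sym (neighbourSum-copies-∘-edgeless G n (label f) (combine b i′) x j))
             (magic ((combine b i′ , x) , j))) i ⟩
      m * k ∎
    where open ≡-Reasoning

module _ (a n q : ℕ) (G : Graph) where
  open Graph G

  private
    p = suc (suc q)
    L = copies (a * p) G ∘ edgeless n
    R = copies a (completeMultipartite n p) ⊗ G

  distanceMagic-⊗⇒∘ : DistanceMagic R → DistanceMagic L
  distanceMagic-⊗⇒∘ (f , k , magic)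
    with g , g≡ ← relabel (reindex {a = a}) (sym (order-reindex a n p order)) f =
    -- The constant must be named before any vertex is given, hence a quotient by p - 1 = `suc q`;
    -- `k≡` later shows the division to be exact.
    g , k / suc q , λ ((c , x) , j) →
      let b = proj₁ (remQuot {a} p c)
          i = proj₂ (remQuot {a} p c)
          s : Fin p → ℕ
          s i′ = fibreSum G (λ (y , h) → label f ((b , (i′ , h)) , y)) x
          k≡ : k ≡ suc q * s i
          k≡ = sum-others≡k⇒k≡m*s s (λ i′ → trans
                 (sym (neighbourSum-copies-⊗ G n (label f) b i′ j x))
                 (magic ((b , (i′ , j)) , x))) i
      in begin
      neighbourSum L (label g) ((c , x) , j)
        ≡⟨ cong sum (map-cong g≡ (Graph.neighbours L ((c , x) , j))) ⟩
      neighbourSum L (λ v → label f (Inverse.to (reindex {a = a}) v)) ((c , x) , j)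
        ≡⟨ neighbourSum-copies-∘-edgeless G n _ c x j ⟩
      s i
        ≡⟨ m*n/n≡m (s i) (suc q) ⟨
      s i * suc q / suc q
        ≡⟨ cong (_/ suc q) (trans (*-comm (s i) (suc q)) (sym k≡)) ⟩
      k / suc q ∎
    where open ≡-Reasoning

theorem16 : (a n p : ℕ) → a ≥ 1 → n > 1 → p > 1 →
    (G : Graph) → Regular G →
    DistanceMagic (copies (a * p) G ∘ edgeless n) ⇔ DistanceMagic (copies a (completeMultipartite n p) ⊗ G)
-- Writing p as q + 2 turns p - 1 into `suc q`, the multiplier in one direction and a nonzero
-- divisor in the other.
theorem16 a n (suc (suc q)) _ _ (s≤s (s≤s _)) G _ =
  mk⇔ (distanceMagic-∘⇒⊗ a n (suc q) G) (distanceMagic-⊗⇒∘ a n q G)
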